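{- Let $h(\alpha) = 1 - \alpha + \sum_{n \ge 2} t_n v^{n-1} e^{n} f\, \alpha^n$ and, for an integer $q \ge 2$, let $h_q(\alpha) = 1 - \alpha + \sum_{n=2}^{q} t_n v^{n-1} e^{n} f\, \alpha^n$. For an integer $d \ge 0$ define $$\beta_{d.} = \sum_{\mathbf{m}:\, V_{\mathbf{m}}-2 \le d} C_{\mathbf{m}} v^{V_{\mathbf{m}}-2}e^{E_{\mathbf{m}}-1}f^{F_{\mathbf{m}}}\mathbf{t}^{\mathbf{m}},\qquad \beta_{d\_} = \sum_{\mathbf{m}:\, E_{\mathbf{m}}-1 \le d} C_{\mathbf{m}} v^{V_{\mathbf{m}}-2}e^{E_{\mathbf{m}}-1}f^{F_{\mathbf{m}}}\mathbf{t}^{\mathbf{m}},$$ $$\beta_{d\Delta} = \sum_{\mathbf{m}:\, F_{\mathbf{m}} \le d} C_{\mathbf{m}} v^{V_{\mathbf{m}}-2}e^{E_{\mathbf{m}}-1}f^{F_{\mathbf{m}}}\mathbf{t}^{\mathbf{m}},\qquad \beta_{d\Delta q} = \sum_{\substack{\mathbf{m} = [m_2,\ldots,m_q]\\ F_{\mathbf{m}} \le d}} C_{\mathbf{m}} v^{V_{\mathbf{m}}-2}e^{E_{\mathbf{m}}-1}f^{F_{\mathbf{m}}}\mathbf{t}^{\mathbf{m}},$$ where in $\beta_{d\Delta q}$ only types with $m_k = 0$ for all $k > q$ are included. Then $$h(\beta_{d.}) \bmod v^{d+1} = 0,\quad h(\beta_{d\_}) \bmod e^{d+1} = 0,\quad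 h(\beta_{d\Delta}) \bmod f^{d+1} = 0,\quad h_q(\beta_{d\Delta q}) \bmod f^{d+1} = 0.$$
   Context: Everything lives in the ring of formal power series over $\mathbb{Q}$ in $t_2, t_3, \ldots, v, e, f$. A type is a vector $\mathbf{m} = [m_2, m_3, \ldots]$ of nonnegative integers with finitely many nonzero entries; $\mathbf{t}^{\mathbf{m}} = \prod_k t_k^{m_k}$, $\mathbf{m}! = \prod_k m_k!$, $V_{\mathbf{m}} = 2 + \sum_{k\ge 2}(k-1)m_k$, $E_{\mathbf{m}} = 1 + \sum_{k\ge 2} k m_k$, $F_{\mathbf{m}} = \sum_{k \ge 2} m_k$, and $C_{\mathbf{m}} = \dfrac{(E_{\mathbf{m}}-1)!}{(V_{\mathbf{m}}-1)!\,\mathbf{m}!}$. For a variable $z \in \{v,e,f\}$, "$X \bmod z^{d+1}$" denotes the series obtained from $X$ by deleting all terms in which the exponent of $z$ is at least $d+1$ (the remainder upon division by $z^{d+1}$). -}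

module Defs where

open import Data.Nat as ℕ using (ℕ; zero; suc; _∸_; _!; NonZero; _≡ᵇ_; _≤ᵇ_; _<ᵇ_)
open import Data.Nat.Properties using (_!≢0; m*n≢0)
open import Data.Bool using (Bool; true; false; _∧_; if_then_else_)
open import Data.Integer using (+_)
open import Data.Rational using (ℚ; 0ℚ; 1ℚ; _/_; _+_; _-_; _*_)
open import Data.Vec using (Vec; []; _∷_)
open import Data.List using (List; []; _∷_; map; upTo; concatMap; foldr)
open import Data.Product using (_×_; _,_)

-- Monomials and formal power series in t₂, t₃, …, v, e, f over ℚ.
--
-- A monomial v^a e^b f^c t^m whose t-part only involves t₂,…,t_{N+1}
-- is represented by (a , b , c , m) with m : Vec ℕ N, where the entry
-- at position i is the exponent of t_{i+2}.  Every monomial is of this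
-- form for all large enough N; a series is given by its coefficient at
-- every such monomial (for every N).

Mono : ℕ → Set
Mono N = ℕ × ℕ × ℕ × Vec ℕ N

Series : Set
Series = (N : ℕ) → Mono N → ℚ

vExp eExp fExp : ∀ {N} → Mono N → ℕ
vExp (a , _ , _ , _) = a
eExp (_ , b , _ , _) = b
fExp (_ , _ , c , _) = c

Σℚ : List ℚ → ℚ
Σℚ = foldr _+_ 0ℚ

range : ℕ → List ℕ
range n = upTo (suc n)

belowVec : ∀ {N} → Vec ℕ N → List (Vec ℕ N)
belowVec [] = [] ∷ []
belowVec (x ∷ xs) = concatMap (λ y → map (y ∷_) (belowVec xs)) (range x)

divisors : ∀ {N} → Mono N → List (Mono N)
divisors (a , b , c , m) =
  concatMap (λ a' → concatMap (λ b' → concatMap (λ c' →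
    map (λ m' → (a' , b' , c' , m')) (belowVec m)) (range c)) (range b)) (range a)

vsub : ∀ {N} → Vec ℕ N → Vec ℕ N → Vec ℕ N
vsub [] [] = []
vsub (x ∷ xs) (y ∷ ys) = (x ∸ y) ∷ vsub xs ys

quot : ∀ {N} → Mono N → Mono N → Mono N
quot (a , b , c , m) (a' , b' , c' , m') = (a ∸ a' , b ∸ b' , c ∸ c' , vsub m m')

isZeroVec : ∀ {N} → Vec ℕ N → Bool
isZeroVec [] = true
isZeroVec (x ∷ xs) = (x ≡ᵇ 0) ∧ isZeroVec xs

oneS : Series
oneS N (a , b , c , m) =
  if (a ≡ᵇ 0) ∧ (b ≡ᵇ 0) ∧ (c ≡ᵇ 0) ∧ isZeroVec m then 1ℚ else 0ℚ

_-S_ : Series → Series → Series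
(X -S Y) N M = X N M - Y N M

_+S_ : Series → Series → Series
(X +S Y) N M = X N M + Y N M

zeroS : Series
zeroS N M = 0ℚ

_*S_ : Series → Series → Series
(X *S Y) N M = Σℚ (map (λ M' → X N M' * Y N (quot M M')) (divisors M))

_^S_ : Series → ℕ → Series
X ^S zero = oneS
X ^S suc n = X *S (X ^S n)

ΣS : List Series → Series
ΣS = foldr _+S_ zeroS

-- Statistics of a type m = [m₂, m₃, …] (here m : Vec ℕ N, entry i is m_{i+2})

-- Σ_{k ≥ k₀} w(k) m_k, with the first entry of the vector being m_{k₀}
wsum : ∀ {N} → (ℕ → ℕ) → ℕ → Vec ℕ N → ℕ
wsum w k [] = 0
wsum w k (x ∷ xs) = w k ℕ.* x ℕ.+ wsum w (suc k) xs

V E F : ∀ {N} → Vec ℕ N → ℕ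
V m = 2 ℕ.+ wsum (λ k → k ∸ 1) 2 m
E m = 1 ℕ.+ wsum (λ k → k) 2 m
F m = wsum (λ _ → 1) 2 m

mfact : ∀ {N} → Vec ℕ N → ℕ
mfact [] = 1
mfact (x ∷ xs) = x ! ℕ.* mfact xs

mfact≢0 : ∀ {N} (m : Vec ℕ N) → NonZero (mfact m)
mfact≢0 [] = _
mfact≢0 (x ∷ xs) = m*n≢0 (x !) (mfact xs) {{x !≢0}} {{mfact≢0 xs}}

C : ∀ {N} → Vec ℕ N → ℚ
C m = _/_ (+ ((E m ∸ 1) !)) ((V m ∸ 1) ! ℕ.* mfact m)
        {{m*n≢0 ((V m ∸ 1) !) (mfact m) {{(V m ∸ 1) !≢0}} {{mfact≢0 m}}}}

Cond : Set
Cond = ∀ {N} → Vec ℕ N → Bool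

βS : Cond → Series
βS cond N (a , b , c , m) =
  if cond m ∧ (a ≡ᵇ (V m ∸ 2)) ∧ (b ≡ᵇ (E m ∸ 1)) ∧ (c ≡ᵇ F m) then C m else 0ℚ

-- m_k = 0 for all k > q (first entry of the vector is m_{k})
supportedUpTo : ∀ {N} → ℕ → ℕ → Vec ℕ N → Bool
supportedUpTo q k [] = true
supportedUpTo q k (x ∷ xs) = (if q <ᵇ k then x ≡ᵇ 0 else true) ∧ supportedUpTo q (suc k) xs

β-dot β-under β-Δ : ℕ → Series
β-dot d   = βS (λ m → (V m ∸ 2) ≤ᵇ d)
β-under d = βS (λ m → (E m ∸ 1) ≤ᵇ d)
β-Δ d     = βS (λ m → F m ≤ᵇ d)

β-Δq : ℕ → ℕ → Series
β-Δq d q = βS (λ m → (F m ≤ᵇ d) ∧ supportedUpTo q 2 m)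

-- is the vector (first entry m_k) the unit vector at position n?
unitAt : ∀ {N} → ℕ → ℕ → Vec ℕ N → Bool
unitAt n k [] = n <ᵇ k
unitAt n k (x ∷ xs) = (if k ≡ᵇ n then x ≡ᵇ 1 else x ≡ᵇ 0) ∧ unitAt n (suc k) xs

tvef : ℕ → Series
tvef n N (a , b , c , m) =
  if (a ≡ᵇ (n ∸ 1)) ∧ (b ≡ᵇ n) ∧ (c ≡ᵇ 1) ∧ unitAt n 2 m then 1ℚ else 0ℚ

-- h(α) = 1 - α + Σ_{n ≥ 2} t_n v^{n-1} e^n f α^n.
-- At a monomial involving only t₂,…,t_{N+1}, the terms with n > N+1 are
-- divisible by t_n and contribute 0, so the coefficient is the finite sum
-- over n = 2, …, N+1.
h : Series → Series
h X N M = (oneS -S X) N M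
        + ΣS (map (λ n → tvef n *S (X ^S n)) (map (2 ℕ.+_) (upTo N))) N M

hq : ℕ → Series → Series
hq q X = (oneS -S X) +S ΣS (map (λ n → tvef n *S (X ^S n)) (map (2 ℕ.+_) (upTo (q ∸ 1))))

-- X mod z^{d+1} = 0 : every coefficient at a monomial whose z-exponent
-- is ≤ d vanishes.
ModZero : (∀ {N} → Mono N → ℕ) → ℕ → Series → Set
ModZero zExp d X = ∀ N (M : Mono N) → zExp M ℕ.≤ d → X N M ≡ 0ℚ
  where open import Relation.Binary.PropositionalEquality using (_≡_)

{-# OPTIONS --safe #-}
module Submission where

-- Let G r have the coefficients r (e + r − 1)! / ((v + r)! m!) with v = V − 2 and e = E − 1
-- (and G 0 = 1), so that G 1 has the coefficients C. Comparing fractions gives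
-- G (r + 1) = G r + Σₙ tₙ G (r + n); multiplying this by G s and inducting on (F m, r) gives
-- G r · G s = G (r + s). Hence G n = (G 1)ⁿ, and r = 0 says that G 1 is a root of h.
-- The exponents V − 2, E − 1 and F are additive in m, so v, e and f only record a grading, and
-- truncating at a bounded exponent, or to types with m_k = 0 for k > q, is compatible with products.

open import Defs
open import Algebra.Bundles using (module CommutativeMonoid)
open import Algebra.Properties.CommutativeSemigroup using (interchange)
open import Data.Bool using (Bool; true; false; _∧_; if_then_else_)
open import Data.Bool.Properties using (T-≡; ∧-commutativeMonoid)
open import Data.Empty using (⊥-elim)
import Data.Integer as ℤ
open import Data.Integer.Properties using (pos-+; pos-*)
open import Data.List using (List; []; _∷_; _++_; map; upTo; concatMap)
open import Data.List.Properties using (map-∘; map-upTo)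
open import Data.List.Relation.Unary.All as All using (All; []; _∷_)
import Data.List.Relation.Unary.All.Properties as All
open import Data.Nat as ℕ using (ℕ; zero; suc; _≤_; _<_; s≤s; z≤n; _∸_; _!; _≡ᵇ_; _≤ᵇ_; _<ᵇ_; NonZero)
open import Data.Nat.ListAction using (sum)
import Data.Nat.Properties as ℕ
open import Data.Nat.Solver using (module +-*-Solver)
open import Data.Product using (_×_; _,_)
open import Data.Rational using (ℚ; 0ℚ; 1ℚ; _/_; _+_; _-_; _*_; toℚᵘ)
open import Data.Rational.Properties as ℚ using (toℚᵘ-injective; toℚᵘ-homo-+; toℚᵘ-fromℚᵘ; fromℚᵘ-cong)
open import Data.Rational.Unnormalised as ℚᵘ using (mkℚᵘ; *≡*)
import Data.Rational.Unnormalised.Properties as ℚᵘ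
open import Data.Rational.Solver renaming (module +-*-Solver to +-*-Solverℚ) using ()
open import Data.Vec using (Vec; []; _∷_)
open import Function using (_∘_; Equivalence)
open import Relation.Binary.PropositionalEquality using (_≡_; refl; sym; trans; cong; cong₂; subst; module ≡-Reasoning)

open ≡-Reasoning
open CommutativeMonoid using (commutativeSemigroup)

-- The equation for G 1 alone is nonlinear in the coefficients. Taking all powers G r at once makes
-- it linear, so that it can be checked one type at a time. After cancelling (e + r - 1)! over the
-- common denominator (v + r + 1)! m!, the recurrence becomes (r + 1)(r + e) = r (r + v + 1) + Σₙ (r
-- + n) mₙ; the last sum is r F + e, and e = v + F finishes it. The factorial (e + r - 1)! is
-- meaningless exactly when r = e = 0, so that case is split off. The induction for G r · G s ends
-- because multiplication by tₙ, while it raises the index, evaluates the product at a type with F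
-- smaller by one. The recurrence is stated for types with m_k = 0 beyond a bound q, its sum
-- stopping at n = q. This one form serves h_q, and also h with q = N + 1.

private variable
  A B : Set
  N : ℕ

-- Finite sums

∑ : List A → (A → ℚ) → ℚ
∑ xs f = Σℚ (map f xs)

∑-cong-All : {P : A → Set} {f g : A → ℚ} {xs : List A} → All P xs →
             (∀ x → P x → f x ≡ g x) → ∑ xs f ≡ ∑ xs g
∑-cong-All []         h = refl
∑-cong-All (px ∷ pxs) h = cong₂ _+_ (h _ px) (∑-cong-All pxs h)

∑-cong : (xs : List A) {f g : A → ℚ} → (∀ x → f x ≡ g x) → ∑ xs f ≡ ∑ xs g
∑-cong []       h = refl
∑-cong (x ∷ xs) h = cong₂ _+_ (h x) (∑-cong xs h)

∑-zero : (xs : List A) {f : A → ℚ} → (∀ x → f x ≡ 0ℚ) → ∑ xs f ≡ 0ℚ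
∑-zero []       h = refl
∑-zero (x ∷ xs) h = trans (cong₂ _+_ (h x) (∑-zero xs h)) (ℚ.+-identityˡ 0ℚ)

∑-+ : (xs : List A) (f g : A → ℚ) → ∑ xs (λ x → f x + g x) ≡ ∑ xs f + ∑ xs g
∑-+ []       f g = sym (ℚ.+-identityˡ 0ℚ)
∑-+ (x ∷ xs) f g = trans (cong ((f x + g x) +_) (∑-+ xs f g))
  (interchange (commutativeSemigroup ℚ.+-0-commutativeMonoid) (f x) (g x) (∑ xs f) (∑ xs g))

∑-*ʳ : (xs : List A) (f : A → ℚ) (c : ℚ) → ∑ xs f * c ≡ ∑ xs (λ x → f x * c)
∑-*ʳ []       f c = ℚ.*-zeroˡ c
∑-*ʳ (x ∷ xs) f c = trans (ℚ.*-distribʳ-+ c (f x) (∑ xs f)) (cong (f x * c +_) (∑-*ʳ xs f c))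

∑-swap : (xs : List A) (ys : List B) (f : A → B → ℚ) →
         ∑ xs (λ x → ∑ ys (f x)) ≡ ∑ ys (λ y → ∑ xs (λ x → f x y))
∑-swap []       ys f = sym (∑-zero ys (λ _ → refl))
∑-swap (x ∷ xs) ys f = trans (cong (∑ ys (f x) +_) (∑-swap xs ys f))
                             (sym (∑-+ ys (f x) (λ y → ∑ xs (λ x → f x y))))

∑-++ : (xs ys : List A) (f : A → ℚ) → ∑ (xs ++ ys) f ≡ ∑ xs f + ∑ ys f
∑-++ []       ys f = sym (ℚ.+-identityˡ _)
∑-++ (x ∷ xs) ys f = trans (cong (f x +_) (∑-++ xs ys f)) (sym (ℚ.+-assoc (f x) _ _))

∑-concatMap : (xs : List A) (g : A → List B) (f : B → ℚ) →
              ∑ (concatMap g xs) f ≡ ∑ xs (λ x → ∑ (g x) f)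
∑-concatMap []       g f = refl
∑-concatMap (x ∷ xs) g f = trans (∑-++ (g x) (concatMap g xs) f)
                                 (cong (∑ (g x) f +_) (∑-concatMap xs g f))

∑-map : (xs : List A) (g : A → B) (f : B → ℚ) → ∑ (map g xs) f ≡ ∑ xs (f ∘ g)
∑-map xs g f = cong Σℚ (sym (map-∘ xs))

map-upTo-suc : (f : ℕ → A) (n : ℕ) → map f (upTo (suc n)) ≡ f 0 ∷ map (f ∘ suc) (upTo n)
map-upTo-suc f n = trans (map-upTo f (suc n)) (cong (f 0 ∷_) (sym (map-upTo (f ∘ suc) n)))

∑-upTo-suc : (n : ℕ) (f : ℕ → ℚ) → ∑ (upTo (suc n)) f ≡ f 0 + ∑ (upTo n) (f ∘ suc)
∑-upTo-suc n f = cong Σℚ (map-upTo-suc f n)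

-- Coefficients under a condition

∧-trueˡ : ∀ {a b} → a ∧ b ≡ true → a ≡ true
∧-trueˡ {true} _ = refl

∧-trueʳ : ∀ {a b} → a ∧ b ≡ true → b ≡ true
∧-trueʳ {true} eq = eq

when : Bool → ℚ → ℚ
when b p = if b then p else 0ℚ

when-zero : ∀ b → when b 0ℚ ≡ 0ℚ
when-zero true  = refl
when-zero false = refl

when-∧ : ∀ a b p → when (a ∧ b) p ≡ when a (when b p)
when-∧ true  b p = refl
when-∧ false b p = refl

when-* : ∀ a b p q → when a p * when b q ≡ when (a ∧ b) (p * q)
when-* false b     p q = ℚ.*-zeroˡ (when b q)
when-* true  false p q = ℚ.*-zeroʳ p
when-* true  true  p q = refl

∑-when : (xs : List A) (b : Bool) (f : A → ℚ) → ∑ xs (λ x → when b (f x)) ≡ when b (∑ xs f)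
∑-when xs true  f = refl
∑-when xs false f = ∑-zero xs (λ _ → refl)

-- Power series in the variables t₂, …, t_{N+1} under convolution

conv : (Vec ℕ N → ℚ) → (Vec ℕ N → ℚ) → Vec ℕ N → ℚ
conv x y m = ∑ (belowVec m) (λ m′ → x m′ * y (vsub m m′))

δ : Vec ℕ N → ℚ
δ m = when (isZeroVec m) 1ℚ

pow : (Vec ℕ N → ℚ) → ℕ → Vec ℕ N → ℚ
pow x zero    = δ
pow x (suc n) = conv x (pow x n)

-- Multiplication by t_{i+2}.
shift : ℕ → (Vec ℕ N → ℚ) → Vec ℕ N → ℚ
shift i       x []          = 0ℚ
shift zero    x (zero ∷ m)  = 0ℚ
shift zero    x (suc k ∷ m) = x (k ∷ m)
shift (suc i) x (k ∷ m)     = shift i (λ m → x (k ∷ m)) m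

conv-congˡ : {x x′ : Vec ℕ N → ℚ} (y : Vec ℕ N → ℚ) → (∀ m → x m ≡ x′ m) →
             ∀ m → conv x y m ≡ conv x′ y m
conv-congˡ y h m = ∑-cong (belowVec m) (λ m′ → cong (_* y (vsub m m′)) (h m′))

conv-zeroˡ : {x : Vec ℕ N → ℚ} (y : Vec ℕ N → ℚ) → (∀ m → x m ≡ 0ℚ) → ∀ m → conv x y m ≡ 0ℚ
conv-zeroˡ y h m = ∑-zero (belowVec m) (λ m′ → trans (cong (_* y (vsub m m′)) (h m′)) (ℚ.*-zeroˡ (y (vsub m m′))))

conv-+ˡ : (x x′ y : Vec ℕ N → ℚ) → ∀ m → conv (λ m → x m + x′ m) y m ≡ conv x y m + conv x′ y m
conv-+ˡ x x′ y m = trans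
  (∑-cong (belowVec m) (λ m′ → ℚ.*-distribʳ-+ (y (vsub m m′)) (x m′) (x′ m′)))
  (∑-+ (belowVec m) _ _)

conv-∑ˡ : (js : List A) (x : A → Vec ℕ N → ℚ) (y : Vec ℕ N → ℚ) → ∀ m →
          conv (λ m → ∑ js (λ j → x j m)) y m ≡ ∑ js (λ j → conv (x j) y m)
conv-∑ˡ js x y m = trans
  (∑-cong (belowVec m) (λ m′ → ∑-*ʳ js (λ j → x j m′) (y (vsub m m′))))
  (∑-swap (belowVec m) js _)

-- Inductions on the number of variables rest on this: a Cauchy product in the first variable, with
-- coefficients in the remaining ones.
conv-∷ : (x y : Vec ℕ (suc N) → ℚ) (k : ℕ) (m : Vec ℕ N) →
         conv x y (k ∷ m) ≡ ∑ (range k) (λ j → conv (λ m → x (j ∷ m)) (λ m → y (k ∸ j ∷ m)) m)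
conv-∷ x y k m = trans (∑-concatMap (range k) (λ j → map (j ∷_) (belowVec m)) f)
  (∑-cong (range k) (λ j → ∑-map (belowVec m) (j ∷_) f))
  where
  f : Vec ℕ _ → ℚ
  f m′ = x m′ * y (vsub (k ∷ m) m′)

conv-δˡ : (y : Vec ℕ N → ℚ) (m : Vec ℕ N) → conv δ y m ≡ y m
conv-δˡ y []      = trans (ℚ.+-identityʳ _) (ℚ.*-identityˡ (y []))
conv-δˡ y (k ∷ m) = begin
  conv δ y (k ∷ m)
    ≡⟨ conv-∷ δ y k m ⟩
  ∑ (range k) (λ j → conv (λ m → δ (j ∷ m)) (λ m → y (k ∸ j ∷ m)) m)
    ≡⟨ ∑-upTo-suc k (λ j → conv (λ m → δ (j ∷ m)) (λ m → y (k ∸ j ∷ m)) m) ⟩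
  conv δ (λ m → y (k ∷ m)) m + ∑ (upTo k) (λ j → conv (λ _ → 0ℚ) (λ m → y (k ∸ suc j ∷ m)) m)
    ≡⟨ cong₂ _+_ (conv-δˡ (λ m → y (k ∷ m)) m) (∑-zero (upTo k) (λ j → conv-zeroˡ (λ m → y (k ∸ suc j ∷ m)) (λ _ → refl) m)) ⟩
  y (k ∷ m) + 0ℚ
    ≡⟨ ℚ.+-identityʳ _ ⟩
  y (k ∷ m) ∎

shift-cong : ∀ i {x y : Vec ℕ N → ℚ} → (∀ m → x m ≡ y m) → ∀ m → shift i x m ≡ shift i y m
shift-cong i       h []          = refl
shift-cong zero    h (zero ∷ m)  = refl
shift-cong zero    h (suc k ∷ m) = h (k ∷ m)
shift-cong (suc i) h (k ∷ m)     = shift-cong i (λ m → h (k ∷ m)) m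

shift-∑ : ∀ i (js : List A) (x : A → Vec ℕ N → ℚ) (m : Vec ℕ N) →
          ∑ js (λ j → shift i (x j) m) ≡ shift i (λ m → ∑ js (λ j → x j m)) m
shift-∑ i       js x []          = ∑-zero js (λ _ → refl)
shift-∑ zero    js x (zero ∷ m)  = ∑-zero js (λ _ → refl)
shift-∑ zero    js x (suc k ∷ m) = refl
shift-∑ (suc i) js x (k ∷ m)     = shift-∑ i js (λ j m → x j (k ∷ m)) m

conv-shiftˡ : ∀ i (x y : Vec ℕ N → ℚ) (m : Vec ℕ N) → conv (shift i x) y m ≡ shift i (conv x y) m
conv-shiftˡ i    x y []         = trans (ℚ.+-identityʳ _) (ℚ.*-zeroˡ (y []))
conv-shiftˡ zero x y (zero ∷ m) = trans (conv-∷ (shift 0 x) y 0 m)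
  (trans (ℚ.+-identityʳ _) (conv-zeroˡ (λ m → y (0 ∷ m)) (λ _ → refl) m))
conv-shiftˡ zero x y (suc k ∷ m) = begin
  conv (shift 0 x) y (suc k ∷ m)
    ≡⟨ conv-∷ (shift 0 x) y (suc k) m ⟩
  ∑ (range (suc k)) (λ j → conv (λ m → shift 0 x (j ∷ m)) (λ m → y (suc k ∸ j ∷ m)) m)
    ≡⟨ ∑-upTo-suc (suc k) (λ j → conv (λ m → shift 0 x (j ∷ m)) (λ m → y (suc k ∸ j ∷ m)) m) ⟩
  conv (λ _ → 0ℚ) (λ m → y (suc k ∷ m)) m + ∑ (range k) (λ j → conv (λ m → x (j ∷ m)) (λ m → y (k ∸ j ∷ m)) m)
    ≡⟨ cong₂ _+_ (conv-zeroˡ (λ m → y (suc k ∷ m)) (λ _ → refl) m) (sym (conv-∷ x y k m)) ⟩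
  0ℚ + conv x y (k ∷ m)
    ≡⟨ ℚ.+-identityˡ _ ⟩
  conv x y (k ∷ m) ∎
conv-shiftˡ (suc i) x y (k ∷ m) = begin
  conv (shift (suc i) x) y (k ∷ m)
    ≡⟨ conv-∷ (shift (suc i) x) y k m ⟩
  ∑ (range k) (λ j → conv (shift i (λ m → x (j ∷ m))) (λ m → y (k ∸ j ∷ m)) m)
    ≡⟨ ∑-cong (range k) (λ j → conv-shiftˡ i (λ m → x (j ∷ m)) (λ m → y (k ∸ j ∷ m)) m) ⟩
  ∑ (range k) (λ j → shift i (conv (λ m → x (j ∷ m)) (λ m → y (k ∸ j ∷ m))) m)
    ≡⟨ shift-∑ i (range k) _ m ⟩
  shift i (λ m → ∑ (range k) (λ j → conv (λ m → x (j ∷ m)) (λ m → y (k ∸ j ∷ m)) m)) m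
    ≡⟨ shift-cong i (λ m → sym (conv-∷ x y k m)) m ⟩
  shift i (λ m → conv x y (k ∷ m)) m ∎

-- Decompositions of a type

data Split : Vec ℕ N → Vec ℕ N → Vec ℕ N → Set where
  []  : Split [] [] []
  _∷_ : ∀ {i j k} {m m′ m″ : Vec ℕ N} → i ℕ.+ j ≡ k → Split m′ m″ m → Split (i ∷ m′) (j ∷ m″) (k ∷ m)

-- Truncated subtraction is exact below `m`; recording this as a sum lets additivity of the
-- statistics be proved by induction on `Split`.
belowVec-split : (m : Vec ℕ N) → All (λ m′ → Split m′ (vsub m m′) m) (belowVec m)
belowVec-split []      = [] ∷ []
belowVec-split (k ∷ m) = All.concat⁺ (All.map⁺ (All.map
  (λ { {j} (s≤s j≤k) → All.map⁺ (All.map (ℕ.m+[n∸m]≡n j≤k ∷_) (belowVec-split m)) })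
  (All.all-upTo (suc k))))

wsum-split : ∀ w k {m′ m″ m : Vec ℕ N} → Split m′ m″ m → wsum w k m′ ℕ.+ wsum w k m″ ≡ wsum w k m
wsum-split w k []         = refl
wsum-split w k (_∷_ {i = i} {j} {m = m} {m′} {m″} refl s) = begin
  (w k ℕ.* i ℕ.+ wsum w (suc k) m′) ℕ.+ (w k ℕ.* j ℕ.+ wsum w (suc k) m″)
    ≡⟨ interchange ℕ.+-commutativeSemigroup (w k ℕ.* i) (wsum w (suc k) m′) (w k ℕ.* j) (wsum w (suc k) m″) ⟩
  (w k ℕ.* i ℕ.+ w k ℕ.* j) ℕ.+ (wsum w (suc k) m′ ℕ.+ wsum w (suc k) m″)
    ≡⟨ cong₂ ℕ._+_ (sym (ℕ.*-distribˡ-+ (w k) i j)) (wsum-split w (suc k) s) ⟩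
  w k ℕ.* (i ℕ.+ j) ℕ.+ wsum w (suc k) m ∎

≡ᵇ0-+ : ∀ i j → (i ℕ.+ j ≡ᵇ 0) ≡ (i ≡ᵇ 0) ∧ (j ≡ᵇ 0)
≡ᵇ0-+ zero    j = refl
≡ᵇ0-+ (suc i) j = refl

-- A sum of natural numbers vanishes only if both summands do.
supported-split : ∀ q k {m′ m″ m : Vec ℕ N} → Split m′ m″ m →
                  supportedUpTo q k m ≡ supportedUpTo q k m′ ∧ supportedUpTo q k m″
supported-split q k []         = refl
supported-split q k (_∷_ {i = i} {j} {m′ = m′} {m″} refl s) = trans
  (cong₂ _∧_ (head (q <ᵇ k)) (supported-split q (suc k) s))
  (interchange (commutativeSemigroup ∧-commutativeMonoid) (if q <ᵇ k then i ≡ᵇ 0 else true) _ _ _)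
  where
  head : ∀ b → (if b then i ℕ.+ j ≡ᵇ 0 else true) ≡ (if b then i ≡ᵇ 0 else true) ∧ (if b then j ≡ᵇ 0 else true)
  head true  = ≡ᵇ0-+ i j
  head false = refl

-- The image of `x` under the substitution t_k = 0 for k > q; `conv-restrict` is its
-- multiplicativity.
restrict : ℕ → (Vec ℕ N → ℚ) → Vec ℕ N → ℚ
restrict q x m = when (supportedUpTo q 2 m) (x m)

conv-restrict : ∀ q (x y : Vec ℕ N → ℚ) (m : Vec ℕ N) →
                conv (restrict q x) (restrict q y) m ≡ restrict q (conv x y) m
conv-restrict q x y m = trans
  (∑-cong-All (belowVec-split m) (λ m′ s → trans
    (when-* (supportedUpTo q 2 m′) _ _ _)
    (cong (λ b → when b (x m′ * y (vsub m m′))) (sym (supported-split q 2 s)))))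
  (∑-when (belowVec m) (supportedUpTo q 2 m) _)

-- Removing one variable from a type

at : ℕ → Vec ℕ N → ℕ
at i       []      = 0
at zero    (k ∷ m) = k
at (suc i) (k ∷ m) = at i m

data Inc : ℕ → Vec ℕ N → Vec ℕ N → Set where
  here  : ∀ {k} {m : Vec ℕ N} → Inc 0 (k ∷ m) (suc k ∷ m)
  there : ∀ {i k} {m′ m : Vec ℕ N} → Inc i m′ m → Inc (suc i) (k ∷ m′) (k ∷ m)

-- The evaluation is uniform in `x`, so one case distinction serves both sides of an identity
-- between shifted series. `absent` also keeps the zero exponent, which kills the matching numerator
-- in `shift-G-over-den`.
data ShiftView (i : ℕ) (m : Vec ℕ N) : Set where
  absent  : at i m ≡ 0 → (∀ x → shift i x m ≡ 0ℚ) → ShiftView i m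
  present : ∀ {m′} → Inc i m′ m → (∀ x → shift i x m ≡ x m′) → ShiftView i m

shiftView : ∀ i (m : Vec ℕ N) → ShiftView i m
shiftView i       []          = absent refl (λ _ → refl)
shiftView zero    (zero ∷ m)  = absent refl (λ _ → refl)
shiftView zero    (suc k ∷ m) = present here (λ _ → refl)
shiftView (suc i) (k ∷ m) with shiftView i m
... | absent eq h   = absent eq (λ x → h (λ m → x (k ∷ m)))
... | present inc h = present (there inc) (λ x → h (λ m → x (k ∷ m)))

Inc-wsum : ∀ w k {i} {m′ m : Vec ℕ N} → Inc i m′ m → wsum w k m ≡ w (k ℕ.+ i) ℕ.+ wsum w k m′
Inc-wsum w k (here {k = j} {m}) rewrite ℕ.+-identityʳ k | ℕ.*-suc (w k) j =
  ℕ.+-assoc (w k) (w k ℕ.* j) (wsum w (suc k) m)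
Inc-wsum w k (there {i = i} {j} {m′} inc) rewrite Inc-wsum w (suc k) inc | ℕ.+-suc k i =
  solve 3 (λ a b c → a :+ (b :+ c) := b :+ (a :+ c)) refl (w k ℕ.* j) (w (suc (k ℕ.+ i))) (wsum w (suc k) m′)
  where open +-*-Solver

Inc-mfact : ∀ {i} {m′ m : Vec ℕ N} → Inc i m′ m → mfact m ≡ at i m ℕ.* mfact m′
Inc-mfact (here {k = k} {m}) = ℕ.*-assoc (suc k) (k !) (mfact m)
Inc-mfact (there {i = i} {k} {m′} {m} inc) rewrite Inc-mfact inc =
  solve 3 (λ a b c → a :* (b :* c) := b :* (a :* c)) refl (k !) (at i m) (mfact m′)
  where open +-*-Solver

≤⇒<ᵇ-false : ∀ {a b} → a ≤ b → (b <ᵇ a) ≡ false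
≤⇒<ᵇ-false {b = b} z≤n = refl
≤⇒<ᵇ-false (s≤s p)     = ≤⇒<ᵇ-false p

<⇒<ᵇ-true : ∀ {a b} → a < b → (a <ᵇ b) ≡ true
<⇒<ᵇ-true p = Equivalence.to T-≡ (ℕ.<⇒<ᵇ p)

Inc-supported : ∀ q k {i} {m′ m : Vec ℕ N} → k ℕ.+ i ≤ q → Inc i m′ m →
                supportedUpTo q k m ≡ supportedUpTo q k m′
Inc-supported q k k≤q here rewrite ℕ.+-identityʳ k | ≤⇒<ᵇ-false k≤q = refl
Inc-supported q k k+i≤q (there {i = i} {j} inc) =
  cong (_ ∧_) (Inc-supported q (suc k) (subst (_≤ q) (ℕ.+-suc k i) k+i≤q) inc)

-- The hypothesis `2 + i ≤ q` says that t_{i+2} survives the substitution.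
shift-restrict : ∀ q i (x : Vec ℕ N → ℚ) (m : Vec ℕ N) → 2 ℕ.+ i ≤ q →
                 shift i (restrict q x) m ≡ restrict q (shift i x) m
shift-restrict q i x m 2+i≤q with shiftView i m
... | absent _ h rewrite h (restrict q x) | h x = sym (when-zero (supportedUpTo q 2 m))
... | present {m′} inc h rewrite h (restrict q x) | h x | Inc-supported q 2 2+i≤q inc = refl

-- The coefficients of the powers of β

-- Natural numerators and denominators turn identities between coefficients into cross-multiplied
-- identities in ℕ.
frac : (a b : ℕ) .{{_ : NonZero b}} → ℚ
frac a b = ℤ.+ a / b

frac-≡ : ∀ a b c d .{{_ : NonZero b}} .{{_ : NonZero d}} → a ℕ.* d ≡ c ℕ.* b → frac a b ≡ frac c d
frac-≡ a (suc b) c (suc d) eq = fromℚᵘ-cong {mkℚᵘ (ℤ.+ a) b} {mkℚᵘ (ℤ.+ c) d}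
  (*≡* (trans (sym (pos-* a (suc d))) (trans (cong (ℤ.+_) eq) (pos-* c (suc b)))))

frac-+ : ∀ a b d .{{_ : NonZero d}} → frac a d + frac b d ≡ frac (a ℕ.+ b) d
frac-+ a b (suc d) = toℚᵘ-injective (begin′
  toℚᵘ (frac a (suc d) + frac b (suc d))
    ≈⟨ toℚᵘ-homo-+ (frac a (suc d)) (frac b (suc d)) ⟩
  toℚᵘ (frac a (suc d)) ℚᵘ.+ toℚᵘ (frac b (suc d))
    ≈⟨ ℚᵘ.+-cong (toℚᵘ-fromℚᵘ (mkℚᵘ (ℤ.+ a) d)) (toℚᵘ-fromℚᵘ (mkℚᵘ (ℤ.+ b) d)) ⟩
  mkℚᵘ (ℤ.+ a) d ℚᵘ.+ mkℚᵘ (ℤ.+ b) d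
    ≈⟨ *≡* (trans (cong (ℤ._* ℤ.+ suc d) (sym numerator)) (trans (sym (pos-* (a ℕ.* suc d ℕ.+ b ℕ.* suc d) (suc d)))
         (trans (cong (ℤ.+_) (solve 3 (λ a b d → (a :* d :+ b :* d) :* d := (a :+ b) :* (d :* d)) refl a b (suc d)))
                (pos-* (a ℕ.+ b) (suc d ℕ.* suc d))))) ⟩
  mkℚᵘ (ℤ.+ (a ℕ.+ b)) d
    ≈⟨ ℚᵘ.≃-sym (toℚᵘ-fromℚᵘ (mkℚᵘ (ℤ.+ (a ℕ.+ b)) d)) ⟩
  toℚᵘ (frac (a ℕ.+ b) (suc d)) ∎′)
  where
  open +-*-Solver
  open import Relation.Binary.Reasoning.Setoid ℚᵘ.≃-setoid renaming (begin_ to begin′_; _∎ to _∎′) using (step-≈-⟩)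
  numerator : ℤ.+ (a ℕ.* suc d ℕ.+ b ℕ.* suc d) ≡ ℤ.+ a ℤ.* ℤ.+ suc d ℤ.+ ℤ.+ b ℤ.* ℤ.+ suc d
  numerator = trans (pos-+ (a ℕ.* suc d) (b ℕ.* suc d)) (cong₂ ℤ._+_ (pos-* a (suc d)) (pos-* b (suc d)))

frac-zero : ∀ d .{{_ : NonZero d}} → frac 0 d ≡ 0ℚ
frac-zero d = frac-≡ 0 d 0 1 refl

∑-frac : (xs : List A) (n : A → ℕ) (d : ℕ) .{{_ : NonZero d}} →
         ∑ xs (λ x → frac (n x) d) ≡ frac (sum (map n xs)) d
∑-frac []       n d = sym (frac-zero d)
∑-frac (x ∷ xs) n d = trans (cong (frac (n x) d +_) (∑-frac xs n d)) (frac-+ (n x) (sum (map n xs)) d)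

-- vₘ = V m − 2 and eₘ = E m − 1.
vₘ eₘ : Vec ℕ N → ℕ
vₘ = wsum (λ k → k ∸ 1) 2
eₘ = wsum (λ k → k) 2

den : ℕ → Vec ℕ N → ℕ
den n m = n ! ℕ.* mfact m

den≢0 : ∀ n (m : Vec ℕ N) → NonZero (den n m)
den≢0 n m = ℕ.m*n≢0 (n !) (mfact m) {{n ℕ.!≢0}} {{mfact≢0 m}}

-- G r is β^r: Lagrange inversion gives the coefficient r (e + r − 1)! / ((v + r)! m!).
G : ℕ → Vec ℕ N → ℚ
G zero    m = δ m
G (suc s) m = frac (suc s ℕ.* (s ℕ.+ eₘ m) !) (den (suc (s ℕ.+ vₘ m)) m) {{den≢0 (suc (s ℕ.+ vₘ m)) m}}

C≡G1 : (m : Vec ℕ N) → C m ≡ G 1 m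
C≡G1 m = cong (λ n → frac n (den (suc (vₘ m)) m) {{den≢0 (suc (vₘ m)) m}}) (sym (ℕ.*-identityˡ (eₘ m !)))

-- Since k = (k - 1) + 1, this gives e = v + F, which is Euler's relation V - E + F = 1. The
-- starting index is a successor so that `k ∸ 1` computes.
wsum-pred : ∀ k (m : Vec ℕ N) →
            wsum (λ k → k) (suc k) m ≡ wsum (λ k → k ∸ 1) (suc k) m ℕ.+ wsum (λ _ → 1) (suc k) m
wsum-pred k []      = refl
wsum-pred k (x ∷ m) rewrite wsum-pred (suc k) m =
  solve 4 (λ k x a b → (x :+ k :* x) :+ (a :+ b) := (k :* x :+ a) :+ ((x :+ con 0) :+ b)) refl
    k x (wsum (λ k → k ∸ 1) (suc (suc k)) m) (wsum (λ _ → 1) (suc (suc k)) m)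
  where open +-*-Solver

isZeroVec-wsum : ∀ w k (m : Vec ℕ N) → isZeroVec m ≡ true → wsum w k m ≡ 0
isZeroVec-wsum w k []         _ = refl
isZeroVec-wsum w k (zero ∷ m) z = cong₂ ℕ._+_ (ℕ.*-zeroʳ (w k)) (isZeroVec-wsum w (suc k) m z)

isZeroVec-mfact : (m : Vec ℕ N) → isZeroVec m ≡ true → mfact m ≡ 1
isZeroVec-mfact []         _ = refl
isZeroVec-mfact (zero ∷ m) z = trans (ℕ.+-identityʳ (mfact m)) (isZeroVec-mfact m z)

wsum-zero : ∀ k (m : Vec ℕ N) → wsum (λ k → k) (suc k) m ≡ 0 → isZeroVec m ≡ true
wsum-zero k []         _ = refl
wsum-zero k (zero ∷ m) h rewrite ℕ.*-zeroʳ k = wsum-zero (suc k) m h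

sum-zero : (xs : List A) {n : A → ℕ} → (∀ x → n x ≡ 0) → sum (map n xs) ≡ 0
sum-zero []       h = refl
sum-zero (x ∷ xs) h = cong₂ ℕ._+_ (h x) (sum-zero xs h)

sum-cong : (xs : List A) {n n′ : A → ℕ} → (∀ x → n x ≡ n′ x) → sum (map n xs) ≡ sum (map n′ xs)
sum-cong []       h = refl
sum-cong (x ∷ xs) h = cong₂ ℕ._+_ (h x) (sum-cong xs h)

sum-*ʳ : (xs : List A) (n : A → ℕ) (c : ℕ) → sum (map (λ x → n x ℕ.* c) xs) ≡ sum (map n xs) ℕ.* c
sum-*ʳ []       n c = refl
sum-*ʳ (x ∷ xs) n c = trans (cong (n x ℕ.* c ℕ.+_) (sum-*ʳ xs n c)) (sym (ℕ.*-distribʳ-+ c (n x) (sum (map n xs))))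

-- The indices k, ..., k + K - 1 reach at least q, so support up to `q` leaves no entry out, and
-- `at` gives 0 past the end of the vector. The bracketing `k + (c + i)` matches the index of `G` in
-- the recurrence at k = 2, c = s.
sum-at : ∀ q K c k (m : Vec ℕ N) → suc q ≤ k ℕ.+ K → supportedUpTo q k m ≡ true →
         sum (map (λ i → (k ℕ.+ (c ℕ.+ i)) ℕ.* at i m) (upTo K)) ≡
         c ℕ.* wsum (λ _ → 1) k m ℕ.+ wsum (λ k → k) k m
sum-at q K c k [] _ _ = trans (sum-zero (upTo K) (λ i → ℕ.*-zeroʳ (k ℕ.+ (c ℕ.+ i))))
                              (sym (trans (ℕ.+-identityʳ _) (ℕ.*-zeroʳ c)))
-- No index is left and k > q, so the support condition forces `x` and all later entries to be 0.
sum-at q zero c k (x ∷ m) q<k s rewrite <⇒<ᵇ-true (subst (q <_) (ℕ.+-identityʳ k) q<k) with x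
... | zero rewrite ℕ.*-zeroʳ k = sum-at q zero c (suc k) m (ℕ.m≤n⇒m≤1+n q<k) s
sum-at q (suc K) c k (x ∷ m) q<k+K s = begin
  sum (map (λ i → (k ℕ.+ (c ℕ.+ i)) ℕ.* at i (x ∷ m)) (upTo (suc K)))
    ≡⟨ cong sum (map-upTo-suc (λ i → (k ℕ.+ (c ℕ.+ i)) ℕ.* at i (x ∷ m)) K) ⟩
  (k ℕ.+ (c ℕ.+ 0)) ℕ.* x ℕ.+ sum (map (λ i → (k ℕ.+ (c ℕ.+ suc i)) ℕ.* at i m) (upTo K))
    ≡⟨ cong ((k ℕ.+ (c ℕ.+ 0)) ℕ.* x ℕ.+_) (sum-cong (upTo K) (λ i → cong (ℕ._* at i m)
         (solve 3 (λ k c i → k :+ (c :+ (con 1 :+ i)) := con 1 :+ k :+ (c :+ i)) refl k c i))) ⟩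
  (k ℕ.+ (c ℕ.+ 0)) ℕ.* x ℕ.+ sum (map (λ i → (suc k ℕ.+ (c ℕ.+ i)) ℕ.* at i m) (upTo K))
    ≡⟨ cong ((k ℕ.+ (c ℕ.+ 0)) ℕ.* x ℕ.+_)
         (sum-at q K c (suc k) m (subst (suc q ≤_) (ℕ.+-suc k K) q<k+K) (∧-trueʳ {if q <ᵇ k then x ≡ᵇ 0 else true} s)) ⟩
  (k ℕ.+ (c ℕ.+ 0)) ℕ.* x ℕ.+ (c ℕ.* wsum (λ _ → 1) (suc k) m ℕ.+ wsum (λ k → k) (suc k) m)
    ≡⟨ solve 5 (λ k c x a b → (k :+ (c :+ con 0)) :* x :+ (c :* a :+ b)
                           := c :* ((x :+ con 0) :+ a) :+ (k :* x :+ b)) refl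
         k c x (wsum (λ _ → 1) (suc k) m) (wsum (λ k → k) (suc k) m) ⟩
  c ℕ.* wsum (λ _ → 1) k (x ∷ m) ℕ.+ wsum (λ k → k) k (x ∷ m) ∎
  where open +-*-Solver

-- The fraction is extended by s + v + 1. The hypothesis names t = s + e - 1, the argument of the
-- factorial, and so excludes s = e = 0.
G-over-den : ∀ s t (m : Vec ℕ N) → s ℕ.+ eₘ m ≡ suc t →
             G s m ≡ frac (s ℕ.* t ! ℕ.* suc (s ℕ.+ vₘ m)) (den (suc (s ℕ.+ vₘ m)) m) {{den≢0 (suc (s ℕ.+ vₘ m)) m}}
-- For s = 0 the numerator is 0, and e > 0 makes `m` nonzero, so `δ m` is 0 as well.
G-over-den zero t m eq with isZeroVec m in z
... | true  = ⊥-elim (ℕ.0≢1+n (trans (sym (isZeroVec-wsum (λ k → k) 2 m z)) eq))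
... | false = sym (frac-zero (den (suc (vₘ m)) m) {{den≢0 (suc (vₘ m)) m}})
G-over-den (suc s) t m refl = frac-≡
  (suc s ℕ.* (s ℕ.+ eₘ m) !) (den (suc (s ℕ.+ vₘ m)) m)
  (suc s ℕ.* (s ℕ.+ eₘ m) ! ℕ.* (2 ℕ.+ (s ℕ.+ vₘ m))) (den (2 ℕ.+ (s ℕ.+ vₘ m)) m)
  {{den≢0 (suc (s ℕ.+ vₘ m)) m}} {{den≢0 (2 ℕ.+ (s ℕ.+ vₘ m)) m}}
  (rearrange (suc s ℕ.* (s ℕ.+ eₘ m) !) (2 ℕ.+ (s ℕ.+ vₘ m)) (suc (s ℕ.+ vₘ m) !) (mfact m))
  where
  open +-*-Solver
  rearrange : ∀ a b c f → a ℕ.* (b ℕ.* c ℕ.* f) ≡ a ℕ.* b ℕ.* (c ℕ.* f)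
  rearrange = solve 4 (λ a b c f → a :* (b :* c :* f) := a :* b :* (c :* f)) refl

-- Removing tₙ, n = i + 2, lowers e by n and v by n - 1. The index s + n offsets this, leaving the
-- factorials (s + e - 1)! and (v + s + 1)! of `m` itself; only m! changes, by the factor mₙ.
shift-G-over-den : ∀ i s t (m : Vec ℕ N) → s ℕ.+ eₘ m ≡ suc t →
  shift i (G (2 ℕ.+ (s ℕ.+ i))) m ≡
  frac ((2 ℕ.+ (s ℕ.+ i)) ℕ.* at i m ℕ.* t !) (den (suc (s ℕ.+ vₘ m)) m) {{den≢0 (suc (s ℕ.+ vₘ m)) m}}
shift-G-over-den {N} i s t m eq = by-view (shiftView i m)
  where
  open +-*-Solver
  D : ℕ
  D = den (suc (s ℕ.+ vₘ m)) m
  instance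
    D≢0 : NonZero D
    D≢0 = den≢0 (suc (s ℕ.+ vₘ m)) m
  rearrange : ∀ n t d a f → n ℕ.* t ℕ.* (d ℕ.* (a ℕ.* f)) ≡ n ℕ.* a ℕ.* t ℕ.* (d ℕ.* f)
  rearrange = solve 5 (λ n t d a f → n :* t :* (d :* (a :* f)) := n :* a :* t :* (d :* f)) refl

  by-view : ShiftView i m → shift i (G (2 ℕ.+ (s ℕ.+ i))) m ≡ frac ((2 ℕ.+ (s ℕ.+ i)) ℕ.* at i m ℕ.* t !) D
  by-view (absent z h) = trans (h (G (2 ℕ.+ (s ℕ.+ i)))) (sym (trans
    (cong (λ n → frac (n ℕ.* t !) D) (trans (cong ((2 ℕ.+ (s ℕ.+ i)) ℕ.*_) z) (ℕ.*-zeroʳ (2 ℕ.+ (s ℕ.+ i)))))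
    (frac-zero D)))
  by-view (present {m′} inc h) = trans (h (G (2 ℕ.+ (s ℕ.+ i)))) (frac-≡
    ((2 ℕ.+ (s ℕ.+ i)) ℕ.* (suc (s ℕ.+ i) ℕ.+ eₘ m′) !) (den (2 ℕ.+ (s ℕ.+ i ℕ.+ vₘ m′)) m′)
    ((2 ℕ.+ (s ℕ.+ i)) ℕ.* at i m ℕ.* t !) D
    {{den≢0 (2 ℕ.+ (s ℕ.+ i ℕ.+ vₘ m′)) m′}} cross)
    where
    t-eq : suc (s ℕ.+ i) ℕ.+ eₘ m′ ≡ t
    t-eq = ℕ.suc-injective (trans
      (solve 3 (λ s i e → con 2 :+ (s :+ i) :+ e := s :+ (con 2 :+ i :+ e)) refl s i (eₘ m′))
      (trans (cong (s ℕ.+_) (sym (Inc-wsum (λ k → k) 2 inc))) eq))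
    v-eq : suc (s ℕ.+ vₘ m) ≡ 2 ℕ.+ (s ℕ.+ i ℕ.+ vₘ m′)
    v-eq = trans (cong (λ v → suc (s ℕ.+ v)) (Inc-wsum (λ k → k ∸ 1) 2 inc))
      (solve 3 (λ s i v → con 1 :+ (s :+ (con 1 :+ i :+ v)) := con 2 :+ (s :+ i :+ v)) refl s i (vₘ m′))
    cross : (2 ℕ.+ (s ℕ.+ i)) ℕ.* (suc (s ℕ.+ i) ℕ.+ eₘ m′) ! ℕ.* D ≡
            (2 ℕ.+ (s ℕ.+ i)) ℕ.* at i m ℕ.* t ! ℕ.* den (2 ℕ.+ (s ℕ.+ i ℕ.+ vₘ m′)) m′
    cross = trans
      (cong₂ (λ a b → (2 ℕ.+ (s ℕ.+ i)) ℕ.* a ℕ.* b) (cong _! t-eq) (cong₂ ℕ._*_ (cong _! v-eq) (Inc-mfact inc)))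
      (rearrange (2 ℕ.+ (s ℕ.+ i)) (t !) ((2 ℕ.+ (s ℕ.+ i ℕ.+ vₘ m′)) !) (at i m) (mfact m′))

-- This is β^{s+1} = β^s (1 + Σₙ tₙ βⁿ).
G-recurrence : ∀ q s (m : Vec ℕ N) → supportedUpTo q 2 m ≡ true →
  G (suc s) m ≡ G s m + ∑ (upTo (q ∸ 1)) (λ i → shift i (G (2 ℕ.+ (s ℕ.+ i))) m)
G-recurrence {N} q s m supp = by-size (s ℕ.+ eₘ m) refl
  where
  open +-*-Solver
  D : ℕ
  D = den (suc (s ℕ.+ vₘ m)) m
  instance
    D≢0 : NonZero D
    D≢0 = den≢0 (suc (s ℕ.+ vₘ m)) m
  K : ℕ
  K = q ∸ 1
  -- For q = 0 truncated subtraction gives K = 0, and the bound still holds.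
  q≤K+1 : ∀ q → suc q ≤ 2 ℕ.+ (q ∸ 1)
  q≤K+1 zero    = s≤s z≤n
  q≤K+1 (suc q) = ℕ.≤-refl

  rearrange : ∀ s v f t → suc s ℕ.* ((s ℕ.+ (v ℕ.+ f)) ℕ.* t) ≡
                          s ℕ.* t ℕ.* suc (s ℕ.+ v) ℕ.+ (s ℕ.* f ℕ.+ (v ℕ.+ f)) ℕ.* t
  rearrange = solve 4 (λ s v f t → (con 1 :+ s) :* ((s :+ (v :+ f)) :* t)
                                := s :* t :* (con 1 :+ (s :+ v)) :+ (s :* f :+ (v :+ f)) :* t) refl

  numerators : ∀ t → s ℕ.+ eₘ m ≡ suc t →
    suc s ℕ.* suc t ! ≡
    s ℕ.* t ! ℕ.* suc (s ℕ.+ vₘ m) ℕ.+ sum (map (λ i → (2 ℕ.+ (s ℕ.+ i)) ℕ.* at i m ℕ.* t !) (upTo K))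
  numerators t eq = begin
    suc s ℕ.* (suc t ℕ.* t !)
      ≡⟨ cong (λ n → suc s ℕ.* (n ℕ.* t !)) (sym eq) ⟩
    suc s ℕ.* ((s ℕ.+ eₘ m) ℕ.* t !)
      ≡⟨ cong (λ e → suc s ℕ.* ((s ℕ.+ e) ℕ.* t !)) (wsum-pred 1 m) ⟩
    suc s ℕ.* ((s ℕ.+ (vₘ m ℕ.+ F m)) ℕ.* t !)
      ≡⟨ rearrange s (vₘ m) (F m) (t !) ⟩
    s ℕ.* t ! ℕ.* suc (s ℕ.+ vₘ m) ℕ.+ (s ℕ.* F m ℕ.+ (vₘ m ℕ.+ F m)) ℕ.* t !
      ≡⟨ cong (λ e → s ℕ.* t ! ℕ.* suc (s ℕ.+ vₘ m) ℕ.+ (s ℕ.* F m ℕ.+ e) ℕ.* t !) (sym (wsum-pred 1 m)) ⟩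
    s ℕ.* t ! ℕ.* suc (s ℕ.+ vₘ m) ℕ.+ (s ℕ.* F m ℕ.+ eₘ m) ℕ.* t !
      ≡⟨ cong (λ n → s ℕ.* t ! ℕ.* suc (s ℕ.+ vₘ m) ℕ.+ n ℕ.* t !) (sym (sum-at q K s 2 m (q≤K+1 q) supp)) ⟩
    s ℕ.* t ! ℕ.* suc (s ℕ.+ vₘ m) ℕ.+ sum (map (λ i → (2 ℕ.+ (s ℕ.+ i)) ℕ.* at i m) (upTo K)) ℕ.* t !
      ≡⟨ cong (s ℕ.* t ! ℕ.* suc (s ℕ.+ vₘ m) ℕ.+_) (sym (sum-*ʳ (upTo K) (λ i → (2 ℕ.+ (s ℕ.+ i)) ℕ.* at i m) (t !))) ⟩
    s ℕ.* t ! ℕ.* suc (s ℕ.+ vₘ m) ℕ.+ sum (map (λ i → (2 ℕ.+ (s ℕ.+ i)) ℕ.* at i m ℕ.* t !) (upTo K)) ∎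

  by-size : ∀ n → s ℕ.+ eₘ m ≡ n →
    G (suc s) m ≡ G s m + ∑ (upTo K) (λ i → shift i (G (2 ℕ.+ (s ℕ.+ i))) m)
  by-size (suc t) eq = begin
    frac (suc s ℕ.* (s ℕ.+ eₘ m) !) D
      ≡⟨ cong (λ n → frac n D) (trans (cong (λ n → suc s ℕ.* n !) eq) (numerators t eq)) ⟩
    frac (s ℕ.* t ! ℕ.* suc (s ℕ.+ vₘ m) ℕ.+ sum (map (λ i → (2 ℕ.+ (s ℕ.+ i)) ℕ.* at i m ℕ.* t !) (upTo K))) D
      ≡⟨ sym (frac-+ (s ℕ.* t ! ℕ.* suc (s ℕ.+ vₘ m)) (sum (map (λ i → (2 ℕ.+ (s ℕ.+ i)) ℕ.* at i m ℕ.* t !) (upTo K))) D) ⟩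
    frac (s ℕ.* t ! ℕ.* suc (s ℕ.+ vₘ m)) D + frac (sum (map (λ i → (2 ℕ.+ (s ℕ.+ i)) ℕ.* at i m ℕ.* t !) (upTo K))) D
      ≡⟨ cong₂ _+_ (sym (G-over-den s t m eq))
           (sym (trans (∑-cong (upTo K) (λ i → shift-G-over-den i s t m eq))
                       (∑-frac (upTo K) (λ i → (2 ℕ.+ (s ℕ.+ i)) ℕ.* at i m ℕ.* t !) D))) ⟩
    G s m + ∑ (upTo K) (λ i → shift i (G (2 ℕ.+ (s ℕ.+ i))) m) ∎
  -- Here s = e = 0, so `m` is zero: no variable can be removed from it, and both sides are 1.
  by-size zero eq = trans (G-one s (ℕ.m+n≡0⇒m≡0 s eq)) (sym (cong₂ _+_ (δ-one s (ℕ.m+n≡0⇒m≡0 s eq)) (∑-zero (upTo K) no-shift)))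
    where
    e≡0 : eₘ m ≡ 0
    e≡0 = ℕ.m+n≡0⇒n≡0 s eq
    m≡0 : isZeroVec m ≡ true
    m≡0 = wsum-zero 1 m e≡0
    G-one : ∀ s → s ≡ 0 → G (suc s) m ≡ 1ℚ + 0ℚ
    G-one s refl = frac-≡ (1 ℕ.* eₘ m !) (den (suc (vₘ m)) m) 1 1 {{den≢0 (suc (vₘ m)) m}} cross
      where
      cross : 1 ℕ.* eₘ m ! ℕ.* 1 ≡ 1 ℕ.* den (suc (vₘ m)) m
      cross rewrite e≡0 | isZeroVec-wsum (λ k → k ∸ 1) 2 m m≡0 | isZeroVec-mfact m m≡0 = refl
    δ-one : ∀ s → s ≡ 0 → G s m ≡ 1ℚ
    δ-one s refl rewrite m≡0 = refl
    no-shift : ∀ i → shift i (G (2 ℕ.+ (s ℕ.+ i))) m ≡ 0ℚ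
    no-shift i = by-view (shiftView i m)
      where
      by-view : ShiftView i m → shift i (G (2 ℕ.+ (s ℕ.+ i))) m ≡ 0ℚ
      by-view (absent _ h)    = h (G (2 ℕ.+ (s ℕ.+ i)))
      by-view (present inc _) = ⊥-elim (ℕ.0≢1+n (trans (sym e≡0) (Inc-wsum (λ k → k) 2 inc)))

-- With k = 1, the bound q = N + 1 excludes no type in t₂, ..., t_{N+1}, so the restricted
-- statements specialise to full ones.
supported-full : ∀ k (m : Vec ℕ N) → supportedUpTo (k ℕ.+ N) (suc k) m ≡ true
supported-full k []      = refl
supported-full {suc N} k (x ∷ m) rewrite ≤⇒<ᵇ-false {suc k} {k ℕ.+ suc N} (ℕ.m<m+n k (s≤s z≤n)) | ℕ.+-suc k N =
  supported-full (suc k) m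

-- Multiply the recurrence for G (suc r) by G s and induct on (F m, r) lexicographically.
conv-G : ∀ r s (m : Vec ℕ N) → conv (G r) (G s) m ≡ G (r ℕ.+ s) m
conv-G {N} r s m = go (suc (F m)) r m ℕ.≤-refl
  where
  -- `b` bounds F m from above and makes the descent structural in (b, r).
  go : ∀ b r (m : Vec ℕ N) → F m < b → conv (G r) (G s) m ≡ G (r ℕ.+ s) m
  go b       zero    m _   = conv-δˡ (G s) m
  go (suc b) (suc r) m F<b = begin
    conv (G (suc r)) (G s) m
      ≡⟨ conv-congˡ (G s) (λ m → G-recurrence (suc N) r m (supported-full 1 m)) m ⟩
    conv (λ m → G r m + ∑ (upTo N) (λ i → shift i (G (2 ℕ.+ (r ℕ.+ i))) m)) (G s) m
      ≡⟨ conv-+ˡ (G r) (λ m → ∑ (upTo N) (λ i → shift i (G (2 ℕ.+ (r ℕ.+ i))) m)) (G s) m ⟩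
    conv (G r) (G s) m + conv (λ m → ∑ (upTo N) (λ i → shift i (G (2 ℕ.+ (r ℕ.+ i))) m)) (G s) m
      ≡⟨ cong₂ _+_ (go (suc b) r m F<b) (conv-∑ˡ (upTo N) (λ i → shift i (G (2 ℕ.+ (r ℕ.+ i)))) (G s) m) ⟩
    G (r ℕ.+ s) m + ∑ (upTo N) (λ i → conv (shift i (G (2 ℕ.+ (r ℕ.+ i)))) (G s) m)
      ≡⟨ cong (G (r ℕ.+ s) m +_) (∑-cong (upTo N) shifted) ⟩
    G (r ℕ.+ s) m + ∑ (upTo N) (λ i → shift i (G (2 ℕ.+ (r ℕ.+ s ℕ.+ i))) m)
      ≡⟨ sym (G-recurrence (suc N) (r ℕ.+ s) m (supported-full 1 m)) ⟩
    G (suc (r ℕ.+ s)) m ∎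
    where
    open +-*-Solver
    shifted : ∀ i → conv (shift i (G (2 ℕ.+ (r ℕ.+ i)))) (G s) m ≡ shift i (G (2 ℕ.+ (r ℕ.+ s ℕ.+ i))) m
    shifted i = trans (conv-shiftˡ i (G (2 ℕ.+ (r ℕ.+ i))) (G s) m) (by-view (shiftView i m))
      where
      by-view : ShiftView i m →
                shift i (conv (G (2 ℕ.+ (r ℕ.+ i))) (G s)) m ≡ shift i (G (2 ℕ.+ (r ℕ.+ s ℕ.+ i))) m
      by-view (absent _ h) = trans (h (conv (G (2 ℕ.+ (r ℕ.+ i))) (G s))) (sym (h (G (2 ℕ.+ (r ℕ.+ s ℕ.+ i)))))
      by-view (present {m′} inc h) = begin
        shift i (conv (G (2 ℕ.+ (r ℕ.+ i))) (G s)) m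
          ≡⟨ h (conv (G (2 ℕ.+ (r ℕ.+ i))) (G s)) ⟩
        conv (G (2 ℕ.+ (r ℕ.+ i))) (G s) m′
          -- F m′ is F m - 1, so the bound drops to `b`, and the index is free to grow from r + 1 to
          -- r + i + 2.
          ≡⟨ go b (2 ℕ.+ (r ℕ.+ i)) m′ (ℕ.≤-pred (subst (_< suc b) (Inc-wsum (λ _ → 1) 2 inc) F<b)) ⟩
        G (2 ℕ.+ (r ℕ.+ i) ℕ.+ s) m′
          ≡⟨ cong (λ n → G n m′) (solve 3 (λ r i s → con 2 :+ (r :+ i) :+ s := con 2 :+ (r :+ s :+ i)) refl r i s) ⟩
        G (2 ℕ.+ (r ℕ.+ s ℕ.+ i)) m′
          ≡⟨ sym (h (G (2 ℕ.+ (r ℕ.+ s ℕ.+ i)))) ⟩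
        shift i (G (2 ℕ.+ (r ℕ.+ s ℕ.+ i))) m ∎

-- Series supported on the monomials v^{V−2} e^{E−1} f^F t^m

graded : Mono N → Bool
graded (a , b , c , m) = (a ≡ᵇ vₘ m) ∧ (b ≡ᵇ eₘ m) ∧ (c ≡ᵇ F m)

lift : (Vec ℕ N → ℚ) → Mono N → ℚ
lift x (a , b , c , m) = when (graded (a , b , c , m)) (x m)

≡ᵇ-true : ∀ {i j} → (i ≡ᵇ j) ≡ true → i ≡ j
≡ᵇ-true {i} {j} eq = ℕ.≡ᵇ⇒≡ i j (Equivalence.from T-≡ eq)

when-∧₃ : ∀ a b c p → when (a ∧ b ∧ c) p ≡ when a (when b (when c p))
when-∧₃ a b c p = trans (when-∧ a (b ∧ c) p) (cong (when a) (when-∧ b c p))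

when-*-∧₃ : ∀ a b c a′ b′ c′ p p′ →
  when (a ∧ b ∧ c) p * when (a′ ∧ b′ ∧ c′) p′ ≡ when ((a ∧ a′) ∧ (b ∧ b′)) (when (c ∧ c′) (p * p′))
when-*-∧₃ false b     c a′    b′    c′ p p′ = ℚ.*-zeroˡ (when (a′ ∧ b′ ∧ c′) p′)
when-*-∧₃ true  b     c false b′    c′ p p′ = ℚ.*-zeroʳ (when (b ∧ c) p)
when-*-∧₃ true  false c true  b′    c′ p p′ = ℚ.*-zeroˡ (when (b′ ∧ c′) p′)
when-*-∧₃ true  true  c true  false c′ p p′ = ℚ.*-zeroʳ (when c p)
when-*-∧₃ true  true  c true  true  c′ p p′ = when-* c c′ p p′

-- Only k = i can contribute, and it does exactly when i ≤ n and n - i = j.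
∑-antidiagonal : ∀ n i j z → ∑ (range n) (λ k → when ((k ≡ᵇ i) ∧ (n ∸ k ≡ᵇ j)) z) ≡ when (n ≡ᵇ i ℕ.+ j) z
∑-antidiagonal n zero j z = begin
  ∑ (range n) (λ k → when ((k ≡ᵇ 0) ∧ (n ∸ k ≡ᵇ j)) z)
    ≡⟨ ∑-upTo-suc n (λ k → when ((k ≡ᵇ 0) ∧ (n ∸ k ≡ᵇ j)) z) ⟩
  when (n ≡ᵇ j) z + ∑ (upTo n) (λ k → 0ℚ)
    ≡⟨ cong (when (n ≡ᵇ j) z +_) (∑-zero (upTo n) (λ _ → refl)) ⟩
  when (n ≡ᵇ j) z + 0ℚ
    ≡⟨ ℚ.+-identityʳ (when (n ≡ᵇ j) z) ⟩
  when (n ≡ᵇ j) z ∎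
∑-antidiagonal zero    (suc i) j z = ℚ.+-identityˡ 0ℚ
∑-antidiagonal (suc n) (suc i) j z = begin
  ∑ (range (suc n)) (λ k → when ((k ≡ᵇ suc i) ∧ (suc n ∸ k ≡ᵇ j)) z)
    ≡⟨ ∑-upTo-suc (suc n) (λ k → when ((k ≡ᵇ suc i) ∧ (suc n ∸ k ≡ᵇ j)) z) ⟩
  0ℚ + ∑ (range n) (λ k → when ((k ≡ᵇ i) ∧ (n ∸ k ≡ᵇ j)) z)
    ≡⟨ ℚ.+-identityˡ (∑ (range n) (λ k → when ((k ≡ᵇ i) ∧ (n ∸ k ≡ᵇ j)) z)) ⟩
  ∑ (range n) (λ k → when ((k ≡ᵇ i) ∧ (n ∸ k ≡ᵇ j)) z)
    ≡⟨ ∑-antidiagonal n i j z ⟩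
  when (n ≡ᵇ i ℕ.+ j) z ∎

-- The guard `b` carries the conditions on exponents not yet summed out: `lift-conv` eliminates the
-- three sums innermost first.
∑-antidiagonal-swap : ∀ n (xs : List A) (i j : A → ℕ) (b : A → Bool) (z : A → ℚ) →
  ∑ (range n) (λ k → ∑ xs (λ x → when (b x) (when ((k ≡ᵇ i x) ∧ (n ∸ k ≡ᵇ j x)) (z x)))) ≡
  ∑ xs (λ x → when (b x) (when (n ≡ᵇ i x ℕ.+ j x) (z x)))
∑-antidiagonal-swap n xs i j b z = trans
  (∑-swap (range n) xs (λ k x → when (b x) (when ((k ≡ᵇ i x) ∧ (n ∸ k ≡ᵇ j x)) (z x))))
  (∑-cong xs (λ x → trans
    (∑-when (range n) (b x) (λ k → when ((k ≡ᵇ i x) ∧ (n ∸ k ≡ᵇ j x)) (z x)))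
    (cong (when (b x)) (∑-antidiagonal n (i x) (j x) (z x)))))

∑-divisors : ∀ a b c (m : Vec ℕ N) (f : Mono N → ℚ) → ∑ (divisors (a , b , c , m)) f ≡
  ∑ (range a) (λ a′ → ∑ (range b) (λ b′ → ∑ (range c) (λ c′ → ∑ (belowVec m) (λ m′ → f (a′ , b′ , c′ , m′)))))
∑-divisors a b c m f = trans
  (∑-concatMap (range a) (λ a′ → concatMap (λ b′ → concatMap (λ c′ → row a′ b′ c′) (range c)) (range b)) f)
  (∑-cong (range a) (λ a′ → trans
    (∑-concatMap (range b) (λ b′ → concatMap (λ c′ → row a′ b′ c′) (range c)) f)
    (∑-cong (range b) (λ b′ → trans
      (∑-concatMap (range c) (λ c′ → row a′ b′ c′) f)
      (∑-cong (range c) (λ c′ → ∑-map (belowVec m) (λ m′ → (a′ , b′ , c′ , m′)) f))))))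
  where
  row : ℕ → ℕ → ℕ → List (Mono _)
  row a′ b′ c′ = map (λ m′ → (a′ , b′ , c′ , m′)) (belowVec m)

-- V − 2, E − 1 and F are additive in m, so each exponent of a divisor is determined by its t-part.
lift-conv : (x y : Vec ℕ N → ℚ) (M : Mono N) →
            ∑ (divisors M) (λ M′ → lift x M′ * lift y (quot M M′)) ≡ lift (conv x y) M
lift-conv {N} x y (a , b , c , m) = begin
  ∑ (divisors (a , b , c , m)) (λ M′ → lift x M′ * lift y (quot (a , b , c , m) M′))
    ≡⟨ ∑-divisors a b c m (λ M′ → lift x M′ * lift y (quot (a , b , c , m) M′)) ⟩
  ∑ (range a) (λ a′ → ∑ (range b) (λ b′ → ∑ (range c) (λ c′ → ∑ L (λ m′ →
    lift x (a′ , b′ , c′ , m′) * lift y (a ∸ a′ , b ∸ b′ , c ∸ c′ , vsub m m′)))))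
    ≡⟨ (∑-cong (range a) λ a′ → ∑-cong (range b) λ b′ → ∑-cong (range c) λ c′ → ∑-cong L λ m′ →
         when-*-∧₃ (a′ ≡ᵇ vₘ m′) (b′ ≡ᵇ eₘ m′) (c′ ≡ᵇ F m′)
           (a ∸ a′ ≡ᵇ vₘ (vsub m m′)) (b ∸ b′ ≡ᵇ eₘ (vsub m m′)) (c ∸ c′ ≡ᵇ F (vsub m m′)) (x m′) (y (vsub m m′))) ⟩
  ∑ (range a) (λ a′ → ∑ (range b) (λ b′ → ∑ (range c) (λ c′ → ∑ L (λ m′ →
    when (Av a′ m′ ∧ Be b′ m′) (when ((c′ ≡ᵇ F m′) ∧ (c ∸ c′ ≡ᵇ F (vsub m m′))) (z m′))))))
    ≡⟨ (∑-cong (range a) λ a′ → ∑-cong (range b) λ b′ →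
         trans (∑-antidiagonal-swap c L F (λ m′ → F (vsub m m′)) (λ m′ → Av a′ m′ ∧ Be b′ m′) z)
               (∑-cong L λ m′ → when-∧ (Av a′ m′) (Be b′ m′) (zf m′))) ⟩
  ∑ (range a) (λ a′ → ∑ (range b) (λ b′ → ∑ L (λ m′ → when (Av a′ m′) (when (Be b′ m′) (zf m′)))))
    ≡⟨ (∑-cong (range a) λ a′ → ∑-antidiagonal-swap b L eₘ (λ m′ → eₘ (vsub m m′)) (Av a′) zf) ⟩
  ∑ (range a) (λ a′ → ∑ L (λ m′ → when (Av a′ m′) (when (b ≡ᵇ eₘ m′ ℕ.+ eₘ (vsub m m′)) (zf m′))))
    ≡⟨ ∑-antidiagonal-swap a L vₘ (λ m′ → vₘ (vsub m m′)) (λ _ → true)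
         (λ m′ → when (b ≡ᵇ eₘ m′ ℕ.+ eₘ (vsub m m′)) (zf m′)) ⟩
  ∑ L (λ m′ → when (a ≡ᵇ vₘ m′ ℕ.+ vₘ (vsub m m′)) (when (b ≡ᵇ eₘ m′ ℕ.+ eₘ (vsub m m′)) (zf m′)))
    ≡⟨ ∑-cong-All (belowVec-split m) (λ m′ s → trans
         (cong₂ when (cong (a ≡ᵇ_) (wsum-split (λ k → k ∸ 1) 2 s))
           (cong₂ when (cong (b ≡ᵇ_) (wsum-split (λ k → k) 2 s))
             (cong (λ n → when (c ≡ᵇ n) (z m′)) (wsum-split (λ _ → 1) 2 s))))
         (sym (when-∧₃ (a ≡ᵇ vₘ m) (b ≡ᵇ eₘ m) (c ≡ᵇ F m) (z m′)))) ⟩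
  ∑ L (λ m′ → when (graded (a , b , c , m)) (z m′))
    ≡⟨ ∑-when L (graded (a , b , c , m)) z ⟩
  lift (conv x y) (a , b , c , m) ∎
  where
  L : List (Vec ℕ N)
  L = belowVec m
  z zf : Vec ℕ N → ℚ
  z m′ = x m′ * y (vsub m m′)
  zf m′ = when (c ≡ᵇ F m′ ℕ.+ F (vsub m m′)) (z m′)
  Av Be : ℕ → Vec ℕ N → Bool
  Av a′ m′ = (a′ ≡ᵇ vₘ m′) ∧ (a ∸ a′ ≡ᵇ vₘ (vsub m m′))
  Be b′ m′ = (b′ ≡ᵇ eₘ m′) ∧ (b ∸ b′ ≡ᵇ eₘ (vsub m m′))

-- The series of the statement in graded form

*S-lift : (X Y : Series) (x y : Vec ℕ N → ℚ) → (∀ M → X N M ≡ lift x M) → (∀ M → Y N M ≡ lift y M) →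
          ∀ M → (X *S Y) N M ≡ lift (conv x y) M
*S-lift X Y x y hX hY M = trans
  (∑-cong (divisors M) (λ M′ → cong₂ _*_ (hX M′) (hY (quot M M′))))
  (lift-conv x y M)

-- Common to `oneS` and `tvef`, which test exponents against constants: where the t-part passes the
-- test `u`, the constants are the statistics of `m`; elsewhere both sides are 0.
lift-when : ∀ (x : Vec ℕ N → ℚ) a b c m a₀ b₀ c₀ u → when u 1ℚ ≡ x m →
            (u ≡ true → a₀ ≡ vₘ m × b₀ ≡ eₘ m × c₀ ≡ F m) →
            when ((a ≡ᵇ a₀) ∧ (b ≡ᵇ b₀) ∧ (c ≡ᵇ c₀) ∧ u) 1ℚ ≡ lift x (a , b , c , m)
lift-when x a b c m a₀ b₀ c₀ u eq h = trans
  (trans (when-∧₃ (a ≡ᵇ a₀) (b ≡ᵇ b₀) ((c ≡ᵇ c₀) ∧ u) 1ℚ)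
         (cong (λ p → when (a ≡ᵇ a₀) (when (b ≡ᵇ b₀) p)) (when-∧ (c ≡ᵇ c₀) u 1ℚ)))
  (trans (sym (when-∧₃ (a ≡ᵇ a₀) (b ≡ᵇ b₀) (c ≡ᵇ c₀) (when u 1ℚ)))
         (trans (exponents u h) (cong (when (graded (a , b , c , m))) eq)))
  where
  exponents : ∀ u → (u ≡ true → a₀ ≡ vₘ m × b₀ ≡ eₘ m × c₀ ≡ F m) →
    when ((a ≡ᵇ a₀) ∧ (b ≡ᵇ b₀) ∧ (c ≡ᵇ c₀)) (when u 1ℚ) ≡ when (graded (a , b , c , m)) (when u 1ℚ)
  exponents false _ = trans (when-zero ((a ≡ᵇ a₀) ∧ (b ≡ᵇ b₀) ∧ (c ≡ᵇ c₀))) (sym (when-zero (graded (a , b , c , m))))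
  exponents true h with h refl
  ... | refl , refl , refl = refl

oneS-lift : (M : Mono N) → oneS N M ≡ lift δ M
oneS-lift (a , b , c , m) = lift-when δ a b c m 0 0 0 (isZeroVec m) refl
  (λ z → sym (isZeroVec-wsum (λ k → k ∸ 1) 2 m z) , sym (isZeroVec-wsum (λ k → k) 2 m z) ,
         sym (isZeroVec-wsum (λ _ → 1) 2 m z))

^S-lift : (X : Series) (x : Vec ℕ N → ℚ) → (∀ M → X N M ≡ lift x M) →
          ∀ n M → (X ^S n) N M ≡ lift (pow x n) M
^S-lift X x h zero    M = oneS-lift M
^S-lift X x h (suc n) M = *S-lift X (X ^S n) x (pow x n) h (^S-lift X x h n) M

≡ᵇ-refl : ∀ n → (n ≡ᵇ n) ≡ true
≡ᵇ-refl zero    = refl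
≡ᵇ-refl (suc n) = ≡ᵇ-refl n

>⇒≡ᵇ-false : ∀ {i j} → i < j → (j ≡ᵇ i) ≡ false
>⇒≡ᵇ-false {zero}  (s≤s _) = refl
>⇒≡ᵇ-false {suc i} (s≤s p) = >⇒≡ᵇ-false p

<⇒≡ᵇ-false : ∀ {i j} → i < j → (i ≡ᵇ j) ≡ false
<⇒≡ᵇ-false {zero}  (s≤s _) = refl
<⇒≡ᵇ-false {suc i} (s≤s p) = <⇒≡ᵇ-false p

unitAt-past : ∀ n k (m : Vec ℕ N) → n < k → unitAt n k m ≡ isZeroVec m
unitAt-past n k []      n<k = <⇒<ᵇ-true n<k
unitAt-past n k (x ∷ m) n<k rewrite >⇒≡ᵇ-false n<k = cong (_ ∧_) (unitAt-past n (suc k) m (ℕ.m≤n⇒m≤1+n n<k))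

shift-zero : ∀ i (m : Vec ℕ N) → shift i (λ _ → 0ℚ) m ≡ 0ℚ
shift-zero i       []          = refl
shift-zero zero    (zero ∷ m)  = refl
shift-zero zero    (suc k ∷ m) = refl
shift-zero (suc i) (k ∷ m)     = shift-zero i m

-- The start `k` is general because `unitAt` raises it along the vector while `shift` lowers `i`.
unitAt-shift : ∀ k i (m : Vec ℕ N) → when (unitAt (k ℕ.+ i) k m) 1ℚ ≡ shift i δ m
unitAt-shift k i [] rewrite ≤⇒<ᵇ-false (ℕ.m≤m+n k i) = refl
unitAt-shift k zero (x ∷ m)
  rewrite ℕ.+-identityʳ k | ≡ᵇ-refl k | unitAt-past k (suc k) m ℕ.≤-refl with x
... | zero        = refl
... | suc zero    = refl
... | suc (suc _) = refl
unitAt-shift k (suc i) (x ∷ m) rewrite <⇒≡ᵇ-false (ℕ.m<m+n k {suc i} (s≤s z≤n)) | ℕ.+-suc k i with x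
... | zero  = unitAt-shift (suc k) i m
... | suc _ = sym (shift-zero i m)

-- Read off from `unitAt-shift`: the coefficient in t_{i+2} is 1 only if that variable can be
-- removed and leaves the zero type.
unitAt-wsum : ∀ w i (m : Vec ℕ N) → unitAt (2 ℕ.+ i) 2 m ≡ true → w (2 ℕ.+ i) ≡ wsum w 2 m
unitAt-wsum w i m u with trans (cong (λ u → when u 1ℚ) (sym u)) (unitAt-shift 2 i m) | shiftView i m
... | eq | absent _ h with () ← trans eq (h δ)
... | eq | present {m′} inc h = zero-tail (isZeroVec m′) refl (trans eq (h δ))
  where
  zero-tail : ∀ b → isZeroVec m′ ≡ b → 1ℚ ≡ when b 1ℚ → w (2 ℕ.+ i) ≡ wsum w 2 m
  zero-tail true z _ = sym (trans (Inc-wsum w 2 inc)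
    (trans (cong (w (2 ℕ.+ i) ℕ.+_) (isZeroVec-wsum w 2 m′ z)) (ℕ.+-identityʳ (w (2 ℕ.+ i)))))

tvef-lift : ∀ i (M : Mono N) → tvef (2 ℕ.+ i) N M ≡ lift (shift i δ) M
tvef-lift i (a , b , c , m) = lift-when (shift i δ) a b c m (suc i) (2 ℕ.+ i) 1 (unitAt (2 ℕ.+ i) 2 m) (unitAt-shift 2 i m)
  (λ u → unitAt-wsum (λ k → k ∸ 1) i m u , unitAt-wsum (λ k → k) i m u , unitAt-wsum (λ _ → 1) i m u)

βS-lift : ∀ (cond : Cond) (M : Mono N) → βS cond N M ≡ lift (λ m → when (cond m) (C m)) M
βS-lift cond (a , b , c , m) = swap (cond m) (graded (a , b , c , m))
  where
  swap : ∀ s g → when (s ∧ g) (C m) ≡ when g (when s (C m))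
  swap true  g = refl
  swap false g = sym (when-zero g)

ΣS-map : (xs : List A) (g : A → Series) (M : Mono N) → ΣS (map g xs) N M ≡ ∑ xs (λ x → g x N M)
ΣS-map []       g M = refl
ΣS-map (x ∷ xs) g M = cong (g x _ M +_) (ΣS-map xs g M)

-- Truncated powers and the equation for β

isZeroVec-supported : ∀ q k (m : Vec ℕ N) → isZeroVec m ≡ true → supportedUpTo q k m ≡ true
isZeroVec-supported q k []         _ = refl
isZeroVec-supported q k (zero ∷ m) z with q <ᵇ k
... | true  = isZeroVec-supported q (suc k) m z
... | false = isZeroVec-supported q (suc k) m z

restrict-δ : ∀ q (m : Vec ℕ N) → δ m ≡ restrict q δ m
restrict-δ q m with isZeroVec m in z
... | true rewrite isZeroVec-supported q 2 m z = refl
... | false = sym (when-zero (supportedUpTo q 2 m))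

-- w is the weight of the truncated variable: truncation keeps the types of weight at most d.
module Truncation (q : ℕ) (w : ℕ → ℕ) (d : ℕ) {N : ℕ} (x : Vec ℕ N → ℚ)
                  (x≡G1 : ∀ m → wsum w 2 m ≤ d → x m ≡ restrict q (G 1) m) where

  -- Both parts of a decomposition of `m` weigh at most as much as `m`, so a product at weight ≤ d
  -- never meets a truncated coefficient.
  pow-truncated : ∀ n m → wsum w 2 m ≤ d → pow x n m ≡ restrict q (G n) m
  pow-truncated zero    m m≤d = restrict-δ q m
  pow-truncated (suc n) m m≤d = begin
    conv x (pow x n) m
      ≡⟨ ∑-cong-All (belowVec-split m) (λ m′ s → cong₂ _*_
           (x≡G1 m′ (ℕ.≤-trans (ℕ.m≤m+n _ _) (bound s)))
           (pow-truncated n (vsub m m′) (ℕ.≤-trans (ℕ.m≤n+m _ _) (bound s)))) ⟩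
    conv (restrict q (G 1)) (restrict q (G n)) m
      ≡⟨ conv-restrict q (G 1) (G n) m ⟩
    restrict q (conv (G 1) (G n)) m
      ≡⟨ cong (when (supportedUpTo q 2 m)) (conv-G 1 n m) ⟩
    restrict q (G (suc n)) m ∎
    where
    bound : ∀ {m′ m″} → Split m′ m″ m → wsum w 2 m′ ℕ.+ wsum w 2 m″ ≤ d
    bound s = subst (_≤ d) (sym (wsum-split w 2 s)) m≤d

  shift-pow : ∀ i m → wsum w 2 m ≤ d → 2 ℕ.+ i ≤ q →
              shift i (pow x (2 ℕ.+ i)) m ≡ restrict q (shift i (G (2 ℕ.+ i))) m
  shift-pow i m m≤d 2+i≤q = trans (by-view (shiftView i m)) (shift-restrict q i (G (2 ℕ.+ i)) m 2+i≤q)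
    where
    by-view : ShiftView i m → shift i (pow x (2 ℕ.+ i)) m ≡ shift i (restrict q (G (2 ℕ.+ i))) m
    by-view (absent _ h) = trans (h (pow x (2 ℕ.+ i))) (sym (h (restrict q (G (2 ℕ.+ i)))))
    by-view (present {m′} inc h) = trans (h (pow x (2 ℕ.+ i))) (trans
      (pow-truncated (2 ℕ.+ i) m′ (ℕ.≤-trans (subst (wsum w 2 m′ ≤_) (sym (Inc-wsum w 2 inc)) (ℕ.m≤n+m _ _)) m≤d))
      (sym (h (restrict q (G (2 ℕ.+ i))))))

  -- On supported types this is `G-recurrence` at s = 0, that is G 1 = δ + Σₙ tₙ G n; on all others
  -- every term is 0.
  equation : ∀ m → wsum w 2 m ≤ d →
             (δ m - x m) + ∑ (upTo (q ∸ 1)) (λ i → shift i (pow x (2 ℕ.+ i)) m) ≡ 0ℚ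
  equation m m≤d = begin
    (δ m - x m) + ∑ (upTo (q ∸ 1)) (λ i → shift i (pow x (2 ℕ.+ i)) m)
      ≡⟨ cong₂ _+_ (cong₂ _-_ (restrict-δ q m) (x≡G1 m m≤d))
           (trans (∑-cong-All (All.all-upTo (q ∸ 1)) (λ i i<K → shift-pow i m m≤d (index-bound q i<K)))
                  (∑-when (upTo (q ∸ 1)) (supportedUpTo q 2 m) (λ i → shift i (G (2 ℕ.+ i)) m))) ⟩
    (restrict q δ m - restrict q (G 1) m) + when (supportedUpTo q 2 m) S
      ≡⟨ by-support (supportedUpTo q 2 m) refl ⟩
    0ℚ ∎
    where
    S : ℚ
    S = ∑ (upTo (q ∸ 1)) (λ i → shift i (G (2 ℕ.+ i)) m)
    index-bound : ∀ q {i} → i < q ∸ 1 → 2 ℕ.+ i ≤ q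
    index-bound (suc q) i<q = s≤s i<q
    cancel : ∀ a b → (a - (a + b)) + b ≡ 0ℚ
    cancel = solve 2 (λ a b → (a :- (a :+ b)) :+ b := con 0ℚ) refl
      where open +-*-Solverℚ
    by-support : ∀ s → supportedUpTo q 2 m ≡ s → (when s (δ m) - when s (G 1 m)) + when s S ≡ 0ℚ
    by-support false _    = refl
    by-support true  supp = trans (cong (λ p → (δ m - p) + S) (G-recurrence q 0 m supp)) (cancel (δ m) S)

  -- The weight bound is asked only at graded monomials, where it follows from the bound on the
  -- exponent of v, e or f; at the others every term is 0.
  hq-vanishes : (X : Series) → (∀ M → X N M ≡ lift x M) →
                ∀ a b c m → (graded (a , b , c , m) ≡ true → wsum w 2 m ≤ d) → hq q X N (a , b , c , m) ≡ 0ℚ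
  hq-vanishes X X≡x a b c m bound = begin
    hq q X N M
      ≡⟨ cong₂ _+_ (cong₂ _-_ (oneS-lift M) (X≡x M))
           (trans (ΣS-map (map (2 ℕ.+_) (upTo (q ∸ 1))) (λ n → tvef n *S (X ^S n)) M)
           (trans (∑-map (upTo (q ∸ 1)) (2 ℕ.+_) (λ n → (tvef n *S (X ^S n)) N M))
                  (∑-cong (upTo (q ∸ 1)) term))) ⟩
    (lift δ M - lift x M) + ∑ (upTo (q ∸ 1)) (λ i → lift (shift i (pow x (2 ℕ.+ i))) M)
      ≡⟨ by-grading (graded M) refl ⟩
    0ℚ ∎
    where
    M : Mono N
    M = (a , b , c , m)
    term : ∀ i → (tvef (2 ℕ.+ i) *S (X ^S (2 ℕ.+ i))) N M ≡ lift (shift i (pow x (2 ℕ.+ i))) M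
    term i = trans
      (*S-lift (tvef (2 ℕ.+ i)) (X ^S (2 ℕ.+ i)) (shift i δ) (pow x (2 ℕ.+ i))
        (tvef-lift i) (^S-lift X x X≡x (2 ℕ.+ i)) M)
      (cong (when (graded M)) (trans (conv-shiftˡ i δ (pow x (2 ℕ.+ i)) m)
        (shift-cong i (conv-δˡ (pow x (2 ℕ.+ i))) m)))
    by-grading : ∀ g → graded M ≡ g →
      (when g (δ m) - when g (x m)) + ∑ (upTo (q ∸ 1)) (λ i → when g (shift i (pow x (2 ℕ.+ i)) m)) ≡ 0ℚ
    by-grading true  g = equation m (bound g)
    by-grading false _ = cong ((0ℚ - 0ℚ) +_) (∑-zero (upTo (q ∸ 1)) (λ _ → refl))

≤⇒≤ᵇ-true : ∀ {i j} → i ≤ j → (i ≤ᵇ j) ≡ true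
≤⇒≤ᵇ-true i≤j = Equivalence.to T-≡ (ℕ.≤⇒≤ᵇ i≤j)

truncated-C : ∀ w d (m : Vec ℕ N) → wsum w 2 m ≤ d →
              when (wsum w 2 m ≤ᵇ d) (C m) ≡ restrict (suc N) (G 1) m
truncated-C {N} w d m m≤d = trans (cong₂ when (≤⇒≤ᵇ-true m≤d) (C≡G1 m))
  (cong (λ s → when s (G 1 m)) (sym (supported-full 1 m)))

truncated-C-restrict : ∀ q w d (m : Vec ℕ N) → wsum w 2 m ≤ d →
  when ((wsum w 2 m ≤ᵇ d) ∧ supportedUpTo q 2 m) (C m) ≡ restrict q (G 1) m
truncated-C-restrict q w d m m≤d =
  cong₂ when (cong (_∧ supportedUpTo q 2 m) (≤⇒≤ᵇ-true m≤d)) (C≡G1 m)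

-- h is hq (suc N) on monomials in t₂, …, t_{N+1}, which settles the first three claims.
theorem2 : (d : ℕ) →
    ModZero vExp d (h (β-dot d)) ×
    ModZero eExp d (h (β-under d)) ×
    ModZero fExp d (h (β-Δ d)) ×
    ((q : ℕ) → 2 ≤ q → ModZero fExp d (hq q (β-Δq d q)))
theorem2 d =
  (λ { N (a , b , c , m) a≤d →
    Truncation.hq-vanishes (suc N) (λ k → k ∸ 1) d _ (truncated-C (λ k → k ∸ 1) d)
      (β-dot d) (βS-lift (λ m → (V m ∸ 2) ≤ᵇ d)) a b c m
      (λ g → subst (_≤ d) (≡ᵇ-true (∧-trueˡ g)) a≤d) }) ,
  (λ { N (a , b , c , m) b≤d →
    Truncation.hq-vanishes (suc N) (λ k → k) d _ (truncated-C (λ k → k) d)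
      (β-under d) (βS-lift (λ m → (E m ∸ 1) ≤ᵇ d)) a b c m
      (λ g → subst (_≤ d) (≡ᵇ-true (∧-trueˡ (∧-trueʳ {a ≡ᵇ vₘ m} g))) b≤d) }) ,
  (λ { N (a , b , c , m) c≤d →
    Truncation.hq-vanishes (suc N) (λ _ → 1) d _ (truncated-C (λ _ → 1) d)
      (β-Δ d) (βS-lift (λ m → F m ≤ᵇ d)) a b c m
      (λ g → subst (_≤ d) (≡ᵇ-true (∧-trueʳ {b ≡ᵇ eₘ m} (∧-trueʳ {a ≡ᵇ vₘ m} g))) c≤d) }) ,
  -- Here `q` is independent of `N`: the condition in `β-Δq` removes entries beyond q, and `shift`
  -- is 0 at indices past the end of the vector.
  (λ { q _ N (a , b , c , m) c≤d →
    Truncation.hq-vanishes q (λ _ → 1) d _ (truncated-C-restrict q (λ _ → 1) d)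
      (β-Δq d q) (βS-lift (λ m → (F m ≤ᵇ d) ∧ supportedUpTo q 2 m)) a b c m
      (λ g → subst (_≤ d) (≡ᵇ-true (∧-trueʳ {b ≡ᵇ eₘ m} (∧-trueʳ {a ≡ᵇ vₘ m} g))) c≤d) })
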